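{- Realizability of $\forall^*\exists^*$ HyperLTL is undecidable: there is no algorithm that, given $\mathrm{AP} = I \mathbin{\dot\cup} O$ and a HyperLTL formula $\forall \pi_1 \cdots \forall \pi_n \exists \pi'_1 \cdots \exists \pi'_m.\ \psi$ over $\mathrm{AP}$ ($\psi$ quantifier-free), decides whether it is realizable.
   Context: HyperLTL formulas over $\mathrm{AP}$ are built as $\varphi ::= \exists \pi.\varphi \mid \forall \pi.\varphi \mid \psi$ and $\psi ::= a_\pi \mid \neg\psi \mid \psi\lor\psi \mid \mathsf{X}\psi \mid \psi\,\mathsf{U}\,\psi$ with $a \in \mathrm{AP}$ and trace variables $\pi$. A set of traces $T \subseteq (2^{\mathrm{AP}})^\omega$ satisfies a formula under the standard semantics where quantifiers range over traces in $T$. A strategy is a function $f\colon (2^I)^+ \to 2^O$; the set of traces generated by $f$ consists of all traces $w$ with $w_i \cap O = f((w_0\cap I)\cdots(w_i\cap I))$ for all $i\ge 0$. A formula is realizable if there is a strategy whose set of generated traces satisfies it. -}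

module Defs where

open import Data.Nat using (ℕ; zero; suc; _+_; _≤_; _<_)
open import Data.Fin using (Fin; toℕ) renaming (zero to fzero; suc to fsuc)
open import Data.Bool using (Bool; true; false)
open import Data.Sum using (_⊎_; inj₁; inj₂)
open import Data.Product using (Σ; _×_; _,_)
open import Data.List using (List; []; _∷_; _++_; replicate; upTo)
import Data.List as List
open import Data.List.NonEmpty using (List⁺; _∷⁺_) renaming (_∷_ to _∷ₙ_)
open import Data.Empty using (⊥)
open import Relation.Nullary using (¬_)
open import Relation.Binary.PropositionalEquality using (_≡_)

-- Atomic propositions: AP = I ⊎ O with I = Fin ni, O = Fin no
-- (an arbitrary finite AP with a partition into inputs and outputs,
--  up to renaming of propositions).

AP : ℕ → ℕ → Set
AP ni no = Fin ni ⊎ Fin no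

Letter : ℕ → ℕ → Set
Letter ni no = AP ni no → Bool

Trace : ℕ → ℕ → Set
Trace ni no = ℕ → Letter ni no

-- Quantifier-free body ψ over k trace variables (de Bruijn, Fin k)

data LTL (ni no k : ℕ) : Set where
  ap  : AP ni no → Fin k → LTL ni no k
  neg : LTL ni no k → LTL ni no k
  or  : LTL ni no k → LTL ni no k → LTL ni no k
  X   : LTL ni no k → LTL ni no k
  U   : LTL ni no k → LTL ni no k → LTL ni no k

data Hyper (ni no k : ℕ) : Set where
  ∃π   : Hyper ni no (suc k) → Hyper ni no k
  ∀π   : Hyper ni no (suc k) → Hyper ni no k
  body : LTL ni no k → Hyper ni no k

Assignment : ℕ → ℕ → ℕ → Set
Assignment ni no k = Fin k → Trace ni no

extend : ∀ {ni no k} → Trace ni no → Assignment ni no k → Assignment ni no (suc k)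
extend t Π fzero = t
extend t Π (fsuc x) = Π x

_,_⊨_ : ∀ {ni no k} → Assignment ni no k → ℕ → LTL ni no k → Set
Π , i ⊨ ap a π  = Π π i a ≡ true
Π , i ⊨ neg ψ   = ¬ (Π , i ⊨ ψ)
Π , i ⊨ or ψ χ  = (Π , i ⊨ ψ) ⊎ (Π , i ⊨ χ)
Π , i ⊨ X ψ     = Π , suc i ⊨ ψ
Π , i ⊨ U ψ χ   = Σ ℕ λ j → (i ≤ j) × (Π , j ⊨ χ) ×
                    ((l : ℕ) → i ≤ l → l < j → Π , l ⊨ ψ)

Sat : ∀ {ni no k} → (Trace ni no → Set) → Assignment ni no k → Hyper ni no k → Set
Sat T Π (∃π φ)   = Σ (Trace _ _) λ t → T t × Sat T (extend t Π) φ
Sat T Π (∀π φ)   = (t : Trace _ _) → T t → Sat T (extend t Π) φ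
Sat T Π (body ψ) = Π , 0 ⊨ ψ

emptyAssignment : ∀ {ni no} → Assignment ni no 0
emptyAssignment ()

_⊨ᴴ_ : ∀ {ni no} → (Trace ni no → Set) → Hyper ni no 0 → Set
T ⊨ᴴ φ = Sat T emptyAssignment φ

Strategy : ℕ → ℕ → Set
Strategy ni no = List⁺ (Fin ni → Bool) → (Fin no → Bool)

prefix : ∀ {A : Set} → (ℕ → A) → ℕ → List⁺ A
prefix u i = u 0 ∷ₙ List.map (λ j → u (suc j)) (upTo i)

inputPart : ∀ {ni no} → Trace ni no → ℕ → (Fin ni → Bool)
inputPart w j x = w j (inj₁ x)

Generated : ∀ {ni no} → Strategy ni no → Trace ni no → Set
Generated f w = (i : ℕ) (o : Fin _) →
  w i (inj₂ o) ≡ f (prefix (inputPart w) i) o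

Realizable : ∀ {ni no} → Hyper ni no 0 → Set
Realizable {ni} {no} φ = Σ (Strategy ni no) λ f → Generated f ⊨ᴴ φ

∀ⁿ : ∀ {ni no k} (n : ℕ) → Hyper ni no (n + k) → Hyper ni no k
∀ⁿ zero φ    = φ
∀ⁿ (suc n) φ = ∀ⁿ n (∀π φ)

∃ⁿ : ∀ {ni no k} (m : ℕ) → Hyper ni no (m + k) → Hyper ni no k
∃ⁿ zero φ    = φ
∃ⁿ (suc m) φ = ∃ⁿ m (∃π φ)

record Instance : Set where
  constructor inst
  field
    ni no n m : ℕ
    ψ : LTL ni no (m + (n + 0))

formulaOf : (x : Instance) → Hyper (Instance.ni x) (Instance.no x) 0
formulaOf (inst ni no n m ψ) = ∀ⁿ n (∃ⁿ m (body ψ))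

RealizableInstance : Instance → Set
RealizableInstance x = Realizable (formulaOf x)

encℕ : ℕ → List Bool
encℕ n = replicate n true ++ (false ∷ [])

encLTL : ∀ {ni no k} → LTL ni no k → List Bool
encLTL (ap (inj₁ a) π) = encℕ 0 ++ encℕ 0 ++ encℕ (toℕ a) ++ encℕ (toℕ π)
encLTL (ap (inj₂ a) π) = encℕ 0 ++ encℕ 1 ++ encℕ (toℕ a) ++ encℕ (toℕ π)
encLTL (neg ψ)   = encℕ 1 ++ encLTL ψ
encLTL (or ψ χ)  = encℕ 2 ++ encLTL ψ ++ encLTL χ
encLTL (X ψ)     = encℕ 3 ++ encLTL ψ
encLTL (U ψ χ)   = encℕ 4 ++ encLTL ψ ++ encLTL χ

encode : Instance → List Bool
encode (inst ni no n m ψ) =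
  encℕ ni ++ encℕ no ++ encℕ n ++ encℕ m ++ encLTL ψ

-- Deterministic single-tape Turing machines (bi-infinite tape).
-- Tape alphabet Fin (3 + g): 0 = blank, 1 = bit false, 2 = bit true.

data Move : Set where
  left right : Move

record TM : Set where
  field
    q g : ℕ                    -- states Fin (suc q), start state 0
    δ : Fin (suc q) → Fin (3 + g) →
        Bool ⊎ (Fin (suc q) × Fin (3 + g) × Move)
        -- inj₁ b : halt with answer b (true = accept)

module _ (M : TM) where
  open TM M

  Sym : Set
  Sym = Fin (3 + g)

  blank : Sym
  blank = fzero

  record Config : Set where
    constructor cfg
    field
      state : Fin (suc q)
      lft   : List Sym      -- cells left of the head, nearest first
      head  : Sym
      rgt   : List Sym      -- cells right of the head, nearest first

  moveHead : Move → List Sym → Sym → List Sym → List Sym × Sym × List Sym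
  moveHead left  []      h r = [] , blank , h ∷ r
  moveHead left  (x ∷ l) h r = l , x , h ∷ r
  moveHead right l h []      = h ∷ l , blank , []
  moveHead right l h (x ∷ r) = h ∷ l , x , r

  step : Config → Bool ⊎ Config
  step (cfg s l h r) with δ s h
  ... | inj₁ b = inj₁ b
  ... | inj₂ (s' , w , d) with moveHead d l w r
  ...   | (l' , h' , r') = inj₂ (cfg s' l' h' r')

  run : ℕ → Config → Bool ⊎ Config
  run zero c = inj₂ c
  run (suc k) c with step c
  ... | inj₁ b  = inj₁ b
  ... | inj₂ c' = run k c'

  bitSym : Bool → Sym
  bitSym false = fsuc fzero
  bitSym true  = fsuc (fsuc fzero)

  initial : List Bool → Config
  initial []      = cfg fzero [] blank []
  initial (b ∷ w) = cfg fzero [] (bitSym b) (List.map bitSym w)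

  HaltsWith : List Bool → Bool → Set
  HaltsWith w b = Σ ℕ λ k → run k (initial w) ≡ inj₁ b

Decides : TM → (Instance → Set) → Set
Decides M P = (x : Instance) →
  (P x → HaltsWith M (encode x) true) × (¬ P x → HaltsWith M (encode x) false)

-- Given a Turing machine M, a formula ∀π ∃π′. ψ describes a four-stack machine:
-- a trace whose input is first true at time k has to spell, from time k on, the
-- k-th configuration, and π′ spells the successor of the configuration of π.
-- The shift by k is what makes this causal.  An accepting halt is forbidden, so a
-- rejecting run yields a strategy, while an accepting run refutes every strategy.
-- The word on the initial stack occurs letter by letter at the end of ψ, so the
-- code of the whole instance is A ++ (letter codes of the word) ++ B, where A does
-- not depend on the word and B is constant.  Taking A itself as the word, the stack
-- machine can write down the code of its own instance and run M on it; M then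
-- accepts only if the instance is unrealizable and rejects only if it is realizable.
module Submission where

open import Defs
open import Data.Bool using (Bool; true; false; if_then_else_)
import Data.Bool.Properties as Bool
open import Data.Empty using (⊥; ⊥-elim)
open import Data.Fin using (Fin; join; splitAt; combine; remQuot; _≟_)
  renaming (zero to fzero; suc to fsuc)
open import Data.Fin.Properties using (splitAt-join; remQuot-combine)
open import Data.List
  using (List; []; _∷_; [_]; _++_; _ʳ++_; applyUpTo; concatMap; drop; foldl; foldr; length; map)
open import Data.List.NonEmpty using () renaming (_∷_ to _∷ₙ_)
open import Data.List.Properties
  using (++-assoc; ++-identityʳ; foldl-ʳ++; length-applyUpTo; map-++; map-∘; map-cong;
         map-applyUpTo; map-ʳ++; ʳ++-ʳ++)
open import Data.Nat using (ℕ; zero; suc; _+_; _*_; _∸_)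
open import Data.Nat.Properties using (+-assoc; +-comm; +-identityʳ; +-suc; m+[n∸m]≡n; m≤m+n)
open import Data.Product using (Σ; ∃; _×_; _,_; proj₁; proj₂)
open import Data.Sum using (_⊎_; inj₁; inj₂; [_,_]′; map₂)
open import Data.Vec using (Vec; []; _∷_; lookup; replicate) renaming (map to mapᵛ)
open import Data.Vec.Properties using (lookup-map; lookup-replicate; tabulate∘lookup; tabulate-cong)
open import Function using (_∘_; id)
open import Relation.Binary.PropositionalEquality
  using (_≡_; _≗_; refl; sym; trans; cong; subst; module ≡-Reasoning)
open import Relation.Nullary using (¬_; yes; no; ⌊_⌋)
open import Relation.Nullary.Decidable using (decidable-stable)

lookup-ext : ∀ {A : Set} {k} {v w : Vec A k} → lookup v ≗ lookup w → v ≡ w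
lookup-ext {v = v} {w} e =
  trans (sym (tabulate∘lookup v)) (trans (tabulate-cong e) (tabulate∘lookup w))

⌊≟⌋-refl : ∀ {n} (a : Fin n) → ⌊ a ≟ a ⌋ ≡ true
⌊≟⌋-refl a with a ≟ a
... | yes _  = refl
... | no a≢a = ⊥-elim (a≢a refl)

⌊≟⌋-sound : ∀ {n} {a b : Fin n} → ⌊ a ≟ b ⌋ ≡ true → a ≡ b
⌊≟⌋-sound {a = a} {b} e with a ≟ b
... | yes a≡b = a≡b

shift-index : ∀ m d n → (m + d) + suc n ≡ (suc m + n) + d
shift-index m d n = begin
  (m + d) + suc n   ≡⟨ +-suc (m + d) n ⟩
  suc ((m + d) + n) ≡⟨ cong suc (+-assoc m d n) ⟩
  suc (m + (d + n)) ≡⟨ cong (λ k → suc (m + k)) (+-comm d n) ⟩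
  suc (m + (n + d)) ≡⟨ cong suc (+-assoc m n d) ⟨
  (suc m + n) + d   ∎
  where open ≡-Reasoning

-- A record rather than an equation, so that the three lists can be inferred.
record Splits (ys zs ts : List Bool) : Set where
  constructor splits
  field concatenation : ys ≡ zs ++ ts

open Splits

infixr 4 _▹_
_▹_ : ∀ xs {ys zs ts} → Splits ys zs ts → Splits (xs ++ ys) (xs ++ zs) ts
xs ▹ splits e = splits (trans (cong (xs ++_) e) (sym (++-assoc xs _ _)))

[]▹ : ∀ {ts} → Splits ts [] ts
[]▹ = splits refl

-- Temporal formulas with their classical reading.

data Formula (no : ℕ) : Set where
  atom : AP 1 no → Fin 2 → Formula no
  ⊥ᶠ   : Formula no
  _⇒_  : Formula no → Formula no → Formula no
  _∧ᶠ_ : Formula no → Formula no → Formula no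
  ○    : Formula no → Formula no
  □    : Formula no → Formula no

infixr 4 _⇒_
infixr 5 _∧ᶠ_

module _ {no : ℕ} where

  ⟦_⟧ : Formula no → Assignment 1 no 2 → ℕ → Set
  ⟦ atom a π ⟧ Π m = Π π m a ≡ true
  ⟦ ⊥ᶠ ⟧       Π m = ⊥
  ⟦ f ⇒ g ⟧    Π m = ⟦ f ⟧ Π m → ⟦ g ⟧ Π m
  ⟦ f ∧ᶠ g ⟧   Π m = ⟦ f ⟧ Π m × ⟦ g ⟧ Π m
  ⟦ ○ f ⟧      Π m = ⟦ f ⟧ Π (suc m)
  ⟦ □ f ⟧      Π m = ∀ d → ⟦ f ⟧ Π (m + d)

  -- The syntax has no constants. Excluded middle on one Boolean proposition serves as truth, also
  -- on the left of `U` to express "eventually".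
  tautology : LTL 1 no 2
  tautology = or (ap (inj₁ fzero) fzero) (neg (ap (inj₁ fzero) fzero))

  -- Every connective except ○ starts with a negation, so that compiled
  -- formulas are ¬¬-stable and have their classical meaning constructively.
  compile : Formula no → LTL 1 no 2
  compile (atom a π) = ap a π
  compile ⊥ᶠ         = neg tautology
  compile (f ⇒ g)    = neg (neg (or (neg (compile f)) (compile g)))
  compile (f ∧ᶠ g)   = neg (or (neg (compile f)) (neg (compile g)))
  compile (○ f)      = X (compile f)
  compile (□ f)      = neg (U tautology (neg (compile f)))

  module _ (Π : Assignment 1 no 2) where

    -- Atoms are decidable and `⟦_⟧` contains no disjunction or existential. This lets `sound` argue
    -- from the negation of its goal.
    stable : ∀ f m → ¬ ¬ ⟦ f ⟧ Π m → ⟦ f ⟧ Π m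
    stable (atom a π) m p   = decidable-stable (_ Bool.≟ true) p
    stable ⊥ᶠ m p           = p id
    stable (f ⇒ g) m p x    = stable g m λ q → p λ h → q (h x)
    stable (f ∧ᶠ g) m p     = stable f m (λ q → p (q ∘ proj₁)) , stable g m (λ q → p (q ∘ proj₂))
    stable (○ f) m p        = stable f (suc m) p
    stable (□ f) m p d      = stable f (m + d) λ q → p λ h → q (h d)

    tautology-holds : ∀ m → Π , m ⊨ tautology
    tautology-holds m with Π fzero m (inj₁ fzero)
    ... | true  = inj₁ refl
    ... | false = inj₂ λ ()

    sound    : ∀ f m → Π , m ⊨ compile f → ⟦ f ⟧ Π m
    complete : ∀ f m → ⟦ f ⟧ Π m → Π , m ⊨ compile f

    sound (atom a π) m p = p
    sound ⊥ᶠ m p         = p (tautology-holds m)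
    sound (f ⇒ g) m p x  = stable g m λ q →
      p [ (λ ¬f → ¬f (complete f m x)) , (λ y → q (sound g m y)) ]′
    sound (f ∧ᶠ g) m p   =
      stable f m (λ q → p (inj₁ (q ∘ sound f m))) , stable g m (λ q → p (inj₂ (q ∘ sound g m)))
    sound (○ f) m p      = sound f (suc m) p
    sound (□ f) m p d    = stable f (m + d) λ q →
      p (m + d , m≤m+n m d , q ∘ sound f (m + d) , λ l _ _ → tautology-holds l)

    complete (atom a π) m p = p
    complete ⊥ᶠ m ()
    complete (f ⇒ g) m p q  =
      q (inj₁ λ x → q (inj₂ (complete g m (p (sound f m x)))))
    complete (f ∧ᶠ g) m (x , y) = [ (λ q → q (complete f m x)) , (λ q → q (complete g m y)) ]′
    complete (○ f) m p      = complete f (suc m) p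
    complete (□ f) m p (j , m≤j , q , _) =
      q (complete f j (subst (⟦ f ⟧ Π) (m+[n∸m]≡n m≤j) (p (j ∸ m))))

  ⋀ : ∀ n → (Fin n → Formula no) → Formula no
  ⋀ zero    f = ⊥ᶠ ⇒ ⊥ᶠ
  ⋀ (suc n) f = f fzero ∧ᶠ ⋀ n (f ∘ fsuc)

  ⋀ᵛ : ∀ n k → (Vec (Fin n) k → Formula no) → Formula no
  ⋀ᵛ n zero    f = f []
  ⋀ᵛ n (suc k) f = ⋀ n λ x → ⋀ᵛ n k (f ∘ (x ∷_))

  ○^ : ℕ → Formula no → Formula no
  ○^ zero    f = f
  ○^ (suc n) f = ○ (○^ n f)

  module _ {Π : Assignment 1 no 2} where

    ⋀-elim : ∀ n f {m} → ⟦ ⋀ n f ⟧ Π m → ∀ x → ⟦ f x ⟧ Π m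
    ⋀-elim (suc n) f (p , _) fzero    = p
    ⋀-elim (suc n) f (_ , p) (fsuc x) = ⋀-elim n (f ∘ fsuc) p x

    ⋀-intro : ∀ n f {m} → (∀ x → ⟦ f x ⟧ Π m) → ⟦ ⋀ n f ⟧ Π m
    ⋀-intro zero    f p = id
    ⋀-intro (suc n) f p = p fzero , ⋀-intro n (f ∘ fsuc) (p ∘ fsuc)

    ⋀ᵛ-elim : ∀ n k f {m} → ⟦ ⋀ᵛ n k f ⟧ Π m → ∀ v → ⟦ f v ⟧ Π m
    ⋀ᵛ-elim n zero    f p []      = p
    ⋀ᵛ-elim n (suc k) f p (x ∷ v) = ⋀ᵛ-elim n k (f ∘ (x ∷_)) (⋀-elim n _ p x) v

    ⋀ᵛ-intro : ∀ n k f {m} → (∀ v → ⟦ f v ⟧ Π m) → ⟦ ⋀ᵛ n k f ⟧ Π m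
    ⋀ᵛ-intro n zero    f p = p []
    ⋀ᵛ-intro n (suc k) f p = ⋀-intro n _ λ x → ⋀ᵛ-intro n k (f ∘ (x ∷_)) (p ∘ (x ∷_))

    ○^-elim : ∀ n {f m} → ⟦ ○^ n f ⟧ Π m → ⟦ f ⟧ Π (m + n)
    ○^-elim zero    {f} {m} p = subst (⟦ f ⟧ Π) (sym (+-identityʳ m)) p
    ○^-elim (suc n) {f} {m} p = subst (⟦ f ⟧ Π) (sym (+-suc m n)) (○^-elim n p)

    ○^-intro : ∀ n {f m} → ⟦ f ⟧ Π (m + n) → ⟦ ○^ n f ⟧ Π m
    ○^-intro zero    {f} {m} p = subst (⟦ f ⟧ Π) (+-identityʳ m) p
    ○^-intro (suc n) {f} {m} p = ○^-intro n (subst (⟦ f ⟧ Π) (+-suc m n) p)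

-- Stack machines and configurations spelled on traces.

module Machine (Q C Γ : ℕ) where

  State Stack Symbol : Set
  State  = Fin (suc Q)
  Stack  = Fin (suc C)
  Symbol = Fin (suc Γ)

  Stacks : Set
  Stacks = Vec (List Symbol) (suc C)

  -- A stack stands for an infinite column with blanks below its end.
  cell : List Symbol → ℕ → Symbol
  cell []      _       = fzero
  cell (a ∷ l) zero    = a
  cell (a ∷ l) (suc i) = cell l i

  infix 4 _≈_
  _≈_ : List Symbol → List Symbol → Set
  l ≈ l′ = cell l ≗ cell l′

  top : List Symbol → Symbol
  top l = cell l 0

  tops : Stacks → Vec Symbol (suc C)
  tops = mapᵛ top

  cell-drop : ∀ l i → cell (drop 1 l) i ≡ cell l (suc i)
  cell-drop []      i = refl
  cell-drop (a ∷ l) i = refl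

  ++-congʳ : ∀ p {l l′} → l ≈ l′ → p ++ l ≈ p ++ l′
  ++-congʳ []      e i       = e i
  ++-congʳ (a ∷ p) e zero    = refl
  ++-congʳ (a ∷ p) e (suc i) = ++-congʳ p e i

  -- On an empty stack the left side carries an explicit blank: the lists differ while the columns
  -- agree, hence `≈` instead of equality.
  keep : ∀ l → top l ∷ drop 1 l ≈ l
  keep []      zero    = refl
  keep []      (suc i) = refl
  keep (a ∷ l) i       = refl

  -- A transition always removes the top cell, so a push has to write the symbol it read back below
  -- `p`.
  push : ∀ p l → (p ++ [ top l ]) ++ drop 1 l ≈ p ++ l
  push p l i rewrite ++-assoc p [ top l ] (drop 1 l) = ++-congʳ p (keep l) i

  Outcome : Set
  Outcome = Bool ⊎ State × Stacks

  props : ℕ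
  props = suc Q + suc C * suc Γ

  state-prop : State → Fin props
  state-prop s = join (suc Q) _ (inj₁ s)

  cell-prop : Stack → Symbol → Fin props
  cell-prop c a = join (suc Q) _ (inj₂ (combine c a))

  state′ : State → Fin 2 → Formula props
  state′ s = atom (inj₂ (state-prop s))

  cell′ : Stack → Symbol → Fin 2 → Formula props
  cell′ c a = atom (inj₂ (cell-prop c a))

  -- de Bruijn indices: π′ is quantified inside π
  this next : Fin 2
  this = fsuc fzero
  next = fzero

  -- The continuation `f` sits innermost, so the code of the formula lists the letters in order and
  -- ends with the code of `f`.
  spell : Stack → Fin 2 → List Symbol → Formula props → Formula props
  spell c π []      f = f
  spell c π (a ∷ l) f = cell′ c a π ∧ᶠ ○ (spell c π l f)

  -- Only the presence of the right symbol is demanded: a trace of an arbitrary strategy may show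
  -- further symbols in the same cell.
  Spells : Assignment 1 props 2 → Stack → Fin 2 → List Symbol → ℕ → Set
  Spells Π c π l m = ∀ i → ⟦ cell′ c (cell l i) π ⟧ Π (m + i)

  module _ {Π : Assignment 1 props 2} {c : Stack} {π : Fin 2} where

    Spells-∷ : ∀ {a l m} → ⟦ cell′ c a π ⟧ Π m → Spells Π c π l (suc m) → Spells Π c π (a ∷ l) m
    Spells-∷ {a} {l} {m} p ps zero    = subst (⟦ cell′ c a π ⟧ Π) (sym (+-identityʳ m)) p
    Spells-∷ {a} {l} {m} p ps (suc i) = subst (⟦ cell′ c (cell l i) π ⟧ Π) (sym (+-suc m i)) (ps i)

    Spells-head : ∀ {l m} → Spells Π c π l m → ⟦ cell′ c (top l) π ⟧ Π m
    Spells-head {l} {m} ps = subst (⟦ cell′ c (top l) π ⟧ Π) (+-identityʳ m) (ps 0)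

    Spells-tail : ∀ {l m} → Spells Π c π l m → Spells Π c π (drop 1 l) (suc m)
    Spells-tail {l} {m} ps i rewrite cell-drop l i =
      subst (⟦ cell′ c (cell l (suc i)) π ⟧ Π) (+-suc m i) (ps (suc i))

    Spells-≈ : ∀ {l l′ m} → l ≈ l′ → Spells Π c π l m → Spells Π c π l′ m
    Spells-≈ {m = m} e ps i = subst (λ a → ⟦ cell′ c a π ⟧ Π (m + i)) (e i) (ps i)

    spell-elim : ∀ p {l f m} → ⟦ spell c π p f ⟧ Π m →
      (⟦ f ⟧ Π (m + length p) → Spells Π c π l (m + length p)) → Spells Π c π (p ++ l) m
    spell-elim [] {l} {f} {m} h k =
      subst (Spells Π c π l) (+-identityʳ m) (k (subst (⟦ f ⟧ Π) (sym (+-identityʳ m)) h))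
    spell-elim (a ∷ p) {l} {f} {m} (h , hs) k = Spells-∷ {l = p ++ l} h
      (spell-elim p hs (subst (λ n → ⟦ f ⟧ Π n → Spells Π c π l n) (+-suc m (length p)) k))

    spell-intro : ∀ p {l f m} → Spells Π c π (p ++ l) m →
      (Spells Π c π l (m + length p) → ⟦ f ⟧ Π (m + length p)) → ⟦ spell c π p f ⟧ Π m
    spell-intro [] {l} {f} {m} h k =
      subst (⟦ f ⟧ Π) (+-identityʳ m) (k (subst (Spells Π c π l) (sym (+-identityʳ m)) h))
    spell-intro (a ∷ p) {l} {f} {m} h k = Spells-head {a ∷ p ++ l} h ,
      spell-intro p (Spells-tail {a ∷ p ++ l} h) (subst (λ n → Spells Π c π l n → ⟦ f ⟧ Π n) (+-suc m (length p)) k)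

  ⊤ᶠ : Formula props
  ⊤ᶠ = ⊥ᶠ ⇒ ⊥ᶠ

  copies : Stack → ℕ → Symbol → Formula props
  copies c n a = ○ (cell′ c a this) ⇒ ○^ n (cell′ c a next)

  -- Cell `d + 1` of the current stack, shown at time `m + d + 1`, becomes cell `length p + d` of a
  -- configuration starting at `m + 1`. Seen from time `m + d`, where `copies` is evaluated, the
  -- target is `suc (length p)` steps ahead.
  transfer : Stack → List Symbol → Formula props
  transfer c p = ○ (spell c next p ⊤ᶠ) ∧ᶠ
    □ (⋀ (suc Γ) (copies c (suc (length p))))

  module _ {Π : Assignment 1 props 2} {c : Stack} where

    transfer-elim : ∀ p {l m} → ⟦ transfer c p ⟧ Π m → Spells Π c this l m →
      Spells Π c next (p ++ drop 1 l) (suc m)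
    transfer-elim p {l} {m} (written , copied) h =
      spell-elim p {drop 1 l} written λ _ i →
        subst₂′ (sym (cell-drop l i)) (shift-index m i (length p))
          (○^-elim (suc (length p)) {cell′ c _ next} (⋀-elim (suc Γ) (copies c _) (copied i) (cell l (suc i))
            (subst (⟦ cell′ c (cell l (suc i)) this ⟧ Π) (+-suc m i) (h (suc i)))))
      where
      subst₂′ : ∀ {a b n k} → a ≡ b → n ≡ k → ⟦ cell′ c a next ⟧ Π n → ⟦ cell′ c b next ⟧ Π k
      subst₂′ refl refl x = x

    -- `copies` fires for every symbol shown on `this`, so this direction must also exclude wrong
    -- symbols; the second hypothesis does so.
    transfer-intro : ∀ p {l m} → Spells Π c next (p ++ drop 1 l) (suc m) →
      (∀ d a → ⟦ cell′ c a this ⟧ Π (suc (m + d)) → a ≡ cell l (suc d)) →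
      ⟦ transfer c p ⟧ Π m
    transfer-intro p {l} {m} h exact =
      spell-intro p h (λ _ → id) ,
      λ d → ⋀-intro (suc Γ) (copies c _) λ a x → ○^-intro (suc (length p)) {cell′ c a next} (copy d a (exact d a x))
      where
      rest : ∀ p m → Spells Π c next (p ++ drop 1 l) m → Spells Π c next (drop 1 l) (m + length p)
      rest []      m h = subst (Spells Π c next (drop 1 l)) (sym (+-identityʳ m)) h
      rest (a ∷ p) m h = subst (Spells Π c next (drop 1 l)) (sym (+-suc m (length p)))
        (rest p (suc m) (Spells-tail {Π} {c} {next} {a ∷ p ++ drop 1 l} h))
      copy : ∀ d a → a ≡ cell l (suc d) → ⟦ cell′ c a next ⟧ Π ((m + d) + suc (length p))
      copy d a refl rewrite shift-index m d (length p) =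
        subst (λ a → ⟦ cell′ c a next ⟧ Π ((suc m + length p) + d)) (cell-drop l d) (rest p (suc m) h d)

  -- Encoded configurations and the strategy that outputs them.

  Encodes : Assignment 1 props 2 → Fin 2 → State → Stacks → ℕ → Set
  Encodes Π π s S m = ⟦ state′ s π ⟧ Π m × ∀ c → Spells Π c π (lookup S c) m

  Configuration : Set
  Configuration = State × Stacks

  read : Fin props → State ⊎ Stack × Symbol
  read = map₂ (remQuot (suc Γ)) ∘ splitAt (suc Q)

  read-state : ∀ s → read (state-prop s) ≡ inj₁ s
  read-state s = cong (map₂ (remQuot (suc Γ))) (splitAt-join (suc Q) _ (inj₁ s))

  read-cell : ∀ c a → read (cell-prop c a) ≡ inj₂ (c , a)
  read-cell c a = trans
    (cong (map₂ (remQuot (suc Γ))) (splitAt-join (suc Q) _ (inj₂ (combine c a))))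
    (cong inj₂ (remQuot-combine c a))

  -- A state proposition holds at position 0 only. It marks where a configuration begins, so that on
  -- these outputs the rules, though imposed at all times, trigger only there.
  shows : Configuration → ℕ → State ⊎ Stack × Symbol → Bool
  shows (s , S) zero    (inj₁ s′)      = ⌊ s′ ≟ s ⌋
  shows (s , S) (suc i) (inj₁ s′)      = false
  shows (s , S) i       (inj₂ (c , a)) = ⌊ a ≟ cell (lookup S c) i ⌋

  output : Configuration → ℕ → Fin props → Bool
  output k i = shows k i ∘ read

  output-state : ∀ s S → output (s , S) 0 (state-prop s) ≡ true
  output-state s S rewrite read-state s = ⌊≟⌋-refl s

  output-state⁻ : ∀ s S i {s′} → output (s , S) i (state-prop s′) ≡ true → i ≡ 0 × s′ ≡ s
  output-state⁻ s S zero {s′} e rewrite read-state s′ = refl , ⌊≟⌋-sound e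
  output-state⁻ s S (suc i) {s′} e rewrite read-state s′ with () ← e

  shows-cell : ∀ s S i c a → shows (s , S) i (inj₂ (c , a)) ≡ ⌊ a ≟ cell (lookup S c) i ⌋
  shows-cell s S zero    c a = refl
  shows-cell s S (suc i) c a = refl

  output-cell : ∀ s S i c → output (s , S) i (cell-prop c (cell (lookup S c) i)) ≡ true
  output-cell s S i c rewrite read-cell c (cell (lookup S c) i) =
    trans (shows-cell s S i c _) (⌊≟⌋-refl (cell (lookup S c) i))

  output-cell⁻ : ∀ s S i c {a} → output (s , S) i (cell-prop c a) ≡ true → a ≡ cell (lookup S c) i
  output-cell⁻ s S i c {a} e rewrite read-cell c a =
    ⌊≟⌋-sound (trans (sym (shows-cell s S i c a)) e)

  -- After an input false^k true …, the strategy waits for k steps and then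
  -- outputs the k-th configuration, one cell of every stack per step.
  respond : (ℕ → Configuration) → List (Fin 1 → Bool) → Fin props → Bool
  respond cs []       o = false
  respond cs (x ∷ xs) o =
    if x fzero then output (cs 0) (length xs) o else respond (cs ∘ suc) xs o

  strategy : (ℕ → Configuration) → Strategy 1 props
  strategy cs (x ∷ₙ xs) = respond cs (x ∷ xs)

  FirstTrue : (ℕ → Fin 1 → Bool) → ℕ → Set
  FirstTrue u zero    = u 0 fzero ≡ true
  FirstTrue u (suc j) = u 0 fzero ≡ false × FirstTrue (u ∘ suc) j

  respond-first : ∀ cs {u} j i o → FirstTrue u j →
    respond cs (applyUpTo u (suc (j + i))) o ≡ output (cs j) i o
  respond-first cs {u} zero i o h
    rewrite h | length-applyUpTo (u ∘ suc) i = refl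
  respond-first cs (suc j) i o (h , hs)
    rewrite h = respond-first (cs ∘ suc) j i o hs

  respond-state : ∀ cs u j {s} → respond cs (applyUpTo u (suc j)) (state-prop s) ≡ true →
    FirstTrue u j × s ≡ proj₁ (cs j)
  respond-state cs u zero {s} e with u 0 fzero
  ... | true = refl , proj₂ (output-state⁻ (proj₁ (cs 0)) (proj₂ (cs 0)) 0 {s} e)
  respond-state cs u zero () | false
  respond-state cs u (suc j) {s} e with u 0 fzero
  -- The first true input lies strictly in the past, so the position shown is positive and no state
  -- proposition holds there.
  ... | true with () ← proj₁ (output-state⁻ (proj₁ (cs 0)) (proj₂ (cs 0)) (suc (length (applyUpTo (u ∘ suc ∘ suc) j))) {s} e)
  ... | false with h , e′ ← respond-state (cs ∘ suc) (u ∘ suc) j e = (refl , h) , e′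

  -- Prepending one `false` moves the first true input from `k` to `k + 1`, so the same strategy
  -- answers with the successor configuration, one step later.
  delay : (ℕ → Fin 1 → Bool) → ℕ → Fin 1 → Bool
  delay u zero    _ = false
  delay u (suc j)   = u j

  strategy-prefix : ∀ cs u i o → strategy cs (prefix u i) o ≡ respond cs (applyUpTo u (suc i)) o
  strategy-prefix cs u i o = cong (λ l → respond cs (u 0 ∷ l) o) (map-applyUpTo id (u ∘ suc) i)

  module _ {cs : ℕ → Configuration} {Π : Assignment 1 props 2} {π : Fin 2}
    (generated : Generated (strategy cs) (Π π)) where

    generated-respond : ∀ i o → Π π i (inj₂ o) ≡ respond cs (applyUpTo (inputPart (Π π)) (suc i)) o
    generated-respond i o = trans (generated i o) (strategy-prefix cs (inputPart (Π π)) i o)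

    generated-state : ∀ m {s} → ⟦ state′ s π ⟧ Π m → FirstTrue (inputPart (Π π)) m × s ≡ proj₁ (cs m)
    generated-state m e = respond-state cs (inputPart (Π π)) m
      (trans (sym (generated-respond m _)) e)

    module _ {m} (first : FirstTrue (inputPart (Π π)) m) where

      generated-output : ∀ i o → Π π (m + i) (inj₂ o) ≡ output (cs m) i o
      generated-output i o = trans (generated-respond (m + i) o)
        (respond-first cs {inputPart (Π π)} m i o first)

      generated-encodes : Encodes Π π (proj₁ (cs m)) (proj₂ (cs m)) m
      generated-encodes =
        subst (⟦ state′ (proj₁ (cs m)) π ⟧ Π) (+-identityʳ m)
          (trans (generated-output 0 _) (output-state (proj₁ (cs m)) (proj₂ (cs m)))) ,
        λ c i → trans (generated-output i _) (output-cell (proj₁ (cs m)) (proj₂ (cs m)) i c)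

      generated-cell : ∀ c i {a} → ⟦ cell′ c a π ⟧ Π (m + i) → a ≡ cell (lookup (proj₂ (cs m)) c) i
      generated-cell c i e = output-cell⁻ (proj₁ (cs m)) (proj₂ (cs m)) i c
        (trans (sym (generated-output i _)) e)

  -- The specification of a machine and its correctness.

  letterCode : Symbol → List Bool
  letterCode a = encℕ 1 ++ encℕ 2 ++ encℕ 1 ++ encLTL (compile (cell′ fzero a this)) ++ encℕ 1 ++ encℕ 3

  endCode : List Bool
  endCode = encLTL (compile (□ (cell′ fzero fzero this)))

  module _ (δ : State → Vec Symbol (suc C) → Outcome) where

    -- `p` lists, for each stack, what replaces its top cell. Successors are fixed only up to
    -- trailing blanks, so a simulation may choose convenient lists.
    data Halts : State → Stacks → Bool → Set where
      halt : ∀ {s S b} → δ s (tops S) ≡ inj₁ b → Halts s S b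
      move : ∀ {s S s′ S′ p b} → δ s (tops S) ≡ inj₂ (s′ , p) →
        (∀ c → lookup p c ++ drop 1 (lookup S c) ≈ lookup S′ c) →
        Halts s′ S′ b → Halts s S b

    effect : Outcome → Formula props
    effect (inj₁ true)     = ⊥ᶠ
    effect (inj₁ false)    = ⊤ᶠ
    effect (inj₂ (s , p)) = ○ (state′ s next) ∧ᶠ ⋀ (suc C) λ c → transfer c (lookup p c)

    rule : State → Vec Symbol (suc C) → Formula props
    rule s γ =
      state′ s this ∧ᶠ ⋀ (suc C) (λ c → cell′ c (lookup γ c) this) ⇒ effect (δ s γ)

    rules-at : State → Formula props
    rules-at s = ⋀ᵛ (suc Γ) (suc C) (rule s)

    rules : Formula props
    rules = □ (⋀ (suc Q) rules-at)

    input : Formula props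
    input = atom (inj₁ fzero) this

    others-blank : Formula props
    others-blank = ⋀ C λ c → □ (cell′ (fsuc c) fzero this)

    spec : List Symbol → Formula props
    spec w = rules ∧ᶠ (input ⇒ state′ fzero this ∧ᶠ others-blank ∧ᶠ
      spell fzero this w (□ (cell′ fzero fzero this)))

    problem : List Symbol → Instance
    problem w = inst 1 props 1 1 (compile (spec w))

    start : List Symbol → Stacks
    start w = w ∷ replicate C []

    start-elim : ∀ {Π w} → ⟦ spec w ⟧ Π 0 → ⟦ input ⟧ Π 0 → Encodes Π this fzero (start w) 0
    start-elim {Π} {w} (_ , init) i with init i
    ... | s , others , first = s , λ where
      fzero    → subst (λ l → Spells Π fzero this l 0) (++-identityʳ w) (spell-elim w first λ h → h)
      (fsuc c) → subst (λ l → Spells Π (fsuc c) this l 0) (sym (lookup-replicate c [])) (⋀-elim C _ others c)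

    rule-elim : ∀ {Π w s o m} S → δ s (tops S) ≡ o → ⟦ spec w ⟧ Π 0 → Encodes Π this s S m →
      ⟦ effect o ⟧ Π m
    rule-elim {Π} {s = s} {m = m} S refl (rs , _) (st , cs) =
      ⋀ᵛ-elim (suc Γ) (suc C) (rule s) (⋀-elim (suc Q) rules-at (rs m) s) (tops S)
        (st , ⋀-intro (suc C) (λ c → cell′ c (lookup (tops S) c) this) λ c →
          subst (λ a → ⟦ cell′ c a this ⟧ Π m) (sym (lookup-map c top S)) (Spells-head {Π} {c} {this} {lookup S c} (cs c)))

    effect-elim : ∀ {Π s S s′ S′ p m} → (∀ c → lookup p c ++ drop 1 (lookup S c) ≈ lookup S′ c) →
      ⟦ effect (inj₂ (s′ , p)) ⟧ Π m → Encodes Π this s S m → Encodes Π next s′ S′ (suc m)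
    effect-elim {Π} {S = S} {S′ = S′} {p = p} e (st , ts) (_ , cs) =
      st , λ c → Spells-≈ {Π} {c} {next} {lookup p c ++ drop 1 (lookup S c)} {lookup S′ c} (e c)
        (transfer-elim {Π} {c} (lookup p c) {lookup S c} (⋀-elim (suc C) (λ c → transfer c (lookup p c)) ts c) (cs c))

    module _ {w : List Symbol} where

      -- A trace with input true at time 0 must spell the initial configuration, and each witness
      -- spells the next one, a step later. Following witnesses along the run leads to the accepting
      -- halt, whose effect is `⊥ᶠ`.
      accepting⇒unrealizable : Halts fzero (start w) true → ¬ RealizableInstance (problem w)
      accepting⇒unrealizable h (f , sat) = go t₀ generated₀ h (start-elim (holds t₀ generated₀) refl)
        where
        T : Trace 1 props → Set
        T = Generated f

        t₀ : Trace 1 props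
        t₀ j (inj₁ _) = true
        t₀ j (inj₂ o) = f (prefix (λ _ _ → true) j) o

        generated₀ : T t₀
        generated₀ _ _ = refl

        pair : ∀ t → T t → Assignment 1 props 2
        pair t g = extend (proj₁ (sat t g)) (extend t emptyAssignment)

        holds : ∀ t (g : T t) → ⟦ spec w ⟧ (pair t g) 0
        holds t g = sound (pair t g) (spec w) 0 (proj₂ (proj₂ (sat t g)))

        go : ∀ {s S m} t (g : T t) → Halts s S true → Encodes (pair t g) this s S m → ⊥
        go t g (halt e) enc = rule-elim {w = w} _ e (holds t g) enc
        -- The witness is `next` in the old pair and `this` in the new one; the encoding just
        -- obtained unfolds to the one the recursive call expects.
        go t g (move {S = S} {S′ = S′} {p = p} e l h) enc = go (proj₁ (sat t g)) (proj₁ (proj₂ (sat t g))) h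
          (effect-elim {S = S} {S′ = S′} {p} l (rule-elim {w = w} S e (holds t g) enc) enc)

    Link : Bool → Configuration → Configuration → Set
    Link b (s , S) (s′ , S′) = δ s (tops S) ≡ inj₁ b ⊎ ∃ λ p →
      δ s (tops S) ≡ inj₂ (s′ , p) × (∀ c → lookup p c ++ drop 1 (lookup S c) ≈ lookup S′ c)

    -- The run is padded to an infinite sequence by repeating its halting configuration. At a
    -- rejecting halt `effect` is `⊤ᶠ`, so the padding satisfies the rules.
    configs : ∀ {s S b} → Halts s S b → ℕ → Configuration
    configs {s} {S} h zero         = s , S
    configs {s} {S} (halt _) (suc k) = s , S
    configs (move _ _ h) (suc k)   = configs h k

    configs-linked : ∀ {s S b} (h : Halts s S b) k → Link b (configs h k) (configs h (suc k))
    configs-linked (halt e)                 zero    = inj₁ e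
    configs-linked (halt e)                 (suc k) = inj₁ e
    configs-linked (move {p = p} e l h)     zero    = inj₂ (p , e , l)
    configs-linked (move e l h)             (suc k) = configs-linked h k

    effect-intro : ∀ {Π m} c c′ → Link false c c′ → Encodes Π next (proj₁ c′) (proj₂ c′) (suc m) →
      (∀ k d {a} → ⟦ cell′ k a this ⟧ Π (m + d) → a ≡ cell (lookup (proj₂ c) k) d) →
      ⟦ effect (δ (proj₁ c) (tops (proj₂ c))) ⟧ Π m
    effect-intro _ _ (inj₁ e) _ _ rewrite e = id
    effect-intro {Π} {m} (s , S) (s′ , S′) (inj₂ (p , e , l)) (st , cs) exact rewrite e =
      st , ⋀-intro (suc C) (λ k → transfer k (lookup p k)) λ k → transfer-intro {Π} {k} (lookup p k) {lookup S k}
        (Spells-≈ {Π} {k} {next} {lookup S′ k} {lookup p k ++ drop 1 (lookup S k)} (λ i → sym (l k i)) (cs k))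
        λ d a x → exact k (suc d) (subst (⟦ cell′ k a this ⟧ Π) (sym (+-suc m d)) x)

    rejecting⇒realizable : ∀ {w} → Halts fzero (start w) false → RealizableInstance (problem w)
    rejecting⇒realizable {w} h = strategy cs , λ t g → t′ t , (λ _ _ → refl) ,
      complete (Π t) (spec w) 0 (satisfied t g)
      where
      cs : ℕ → Configuration
      cs = configs h

      t′ : Trace 1 props → Trace 1 props
      t′ t j (inj₁ x) = delay (inputPart t) j x
      t′ t j (inj₂ o) = strategy cs (prefix (delay (inputPart t)) j) o

      Π : Trace 1 props → Assignment 1 props 2
      Π t = extend (t′ t) (extend t emptyAssignment)

      satisfied : ∀ t → Generated (strategy cs) t → ⟦ spec w ⟧ (Π t) 0
      satisfied t g =
        (λ m → ⋀-intro (suc Q) rules-at λ s → ⋀ᵛ-intro (suc Γ) (suc C) (rule s) λ γ → λ (st , cells) →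
          obey m s γ st (⋀-elim (suc C) (λ c → cell′ c (lookup γ c) this) cells)) ,
        λ i → initially (generated-encodes {cs} {Π t} {π = this} g {0} i)
        where
        obey : ∀ m s γ → ⟦ state′ s this ⟧ (Π t) m →
          (∀ c → ⟦ cell′ c (lookup γ c) this ⟧ (Π t) m) → ⟦ effect (δ s γ) ⟧ (Π t) m
        -- The state proposition forces `m` to be the time of the first true input and `s` to be the
        -- state of `cs m`; exactness of the cells then forces `γ` to be its tops. Only the rule of
        -- the actual transition remains.
        obey m s γ st cells with generated-state {cs} {Π t} {π = this} g m st
        ... | first , refl with lookup-ext {v = γ} {tops (proj₂ (cs m))} (λ c → trans
                (generated-cell {cs} {Π t} {π = this} g first c 0
                  (subst (⟦ cell′ c (lookup γ c) this ⟧ (Π t)) (sym (+-identityʳ m)) (cells c)))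
                (sym (lookup-map c top (proj₂ (cs m)))))
        ... | refl = effect-intro {Π t} (cs m) (cs (suc m)) (configs-linked h m)
                (generated-encodes {cs} {Π t} {π = next} (λ _ _ → refl) {suc m} (refl , first))
                (λ c d → generated-cell {cs} {Π t} {π = this} g first c d)

        initially : Encodes (Π t) this fzero (start w) 0 →
          ⟦ state′ fzero this ∧ᶠ others-blank ∧ᶠ spell fzero this w (□ (cell′ fzero fzero this)) ⟧ (Π t) 0
        initially (st , ss) = st ,
          ⋀-intro C _ (λ c → subst (λ l → Spells (Π t) (fsuc c) this l 0) (lookup-replicate c []) (ss (fsuc c))) ,
          spell-intro w (subst (λ l → Spells (Π t) fzero this l 0) (sym (++-identityʳ w)) (ss fzero)) id

    -- The code of the instance as a function of the word.

    spell-code : ∀ w f → encLTL (compile (spell fzero this w f)) ≡ concatMap letterCode w ++ encLTL (compile f)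
    spell-code []      f = refl
    spell-code (a ∷ w) f = begin
      encLTL (compile (spell fzero this (a ∷ w) f))
        -- The tags of one conjunction layer: `neg`, `or`, `neg` before the first conjunct, then
        -- `neg` and `X` before the rest. Nothing follows the last subformula, so codes simply
        -- concatenate.
        ≡⟨ concatenation (encℕ 1 ▹ encℕ 2 ▹ encℕ 1 ▹ encLTL (compile (cell′ fzero a this)) ▹ encℕ 1 ▹ encℕ 3 ▹ []▹) ⟩
      letterCode a ++ encLTL (compile (spell fzero this w f))
        ≡⟨ concatenation (letterCode a ▹ splits (spell-code w f)) ⟩
      concatMap letterCode (a ∷ w) ++ encLTL (compile f) ∎
      where open ≡-Reasoning

    -- It contains `δ` through `rules`, whereas `letterCode` and `endCode` depend on the machine's
    -- sizes alone. A transition function can thus write these two without circularity.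
    codePrefix : List Bool
    codePrefix =
      encℕ 1 ++ encℕ props ++ encℕ 1 ++ encℕ 1 ++
      encℕ 1 ++ encℕ 2 ++ encℕ 1 ++ encLTL (compile rules) ++ encℕ 1 ++
      encℕ 1 ++ encℕ 1 ++ encℕ 2 ++ encℕ 1 ++ encLTL (compile input) ++
      encℕ 1 ++ encℕ 2 ++ encℕ 1 ++ encLTL (compile (state′ fzero this)) ++ encℕ 1 ++
      encℕ 1 ++ encℕ 2 ++ encℕ 1 ++ encLTL (compile others-blank) ++ encℕ 1

    problem-code : ∀ w → encode (problem w) ≡ codePrefix ++ concatMap letterCode w ++ endCode
    problem-code w = trans (concatenation
      (encℕ 1 ▹ encℕ props ▹ encℕ 1 ▹ encℕ 1 ▹
       encℕ 1 ▹ encℕ 2 ▹ encℕ 1 ▹ encLTL (compile rules) ▹ encℕ 1 ▹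
       encℕ 1 ▹ encℕ 1 ▹ encℕ 2 ▹ encℕ 1 ▹ encLTL (compile input) ▹
       encℕ 1 ▹ encℕ 2 ▹ encℕ 1 ▹ encLTL (compile (state′ fzero this)) ▹ encℕ 1 ▹
       encℕ 1 ▹ encℕ 2 ▹ encℕ 1 ▹ encLTL (compile others-blank) ▹ encℕ 1 ▹ []▹))
      (cong (codePrefix ++_) (spell-code w (□ (cell′ fzero fzero this))))

-- The machine that runs `M` on its own instance.

module Diagonal (M : TM) where

  open TM M
  -- Three phases precede the `suc q` states of `M`; four stacks hold the two tape halves and two
  -- scratch copies; the symbols are those of `M`.
  open Machine (3 + q) 3 (2 + g)

  bits : List Bool → List Symbol
  bits = map (bitSym M)

  pattern unload   = fzero
  pattern expand   = fsuc fzero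
  pattern reload   = fsuc (fsuc fzero)
  pattern running s = fsuc (fsuc (fsuc s))

  stacks : ∀ {A : Set} → A → A → A → A → Vec A 4
  stacks l r t u = l ∷ r ∷ t ∷ u ∷ []

  -- The head is the top of the right stack: a left move carries `l` over onto the written `a`, a
  -- right move puts `a` on `l`.
  tapeMove : (l r t u : Symbol) → Bool ⊎ (Fin (suc q) × Symbol × Move) → Outcome
  tapeMove l r t u (inj₁ b)               = inj₁ b
  tapeMove l r t u (inj₂ (s , a , left))  = inj₂ (running s , stacks [] (l ∷ a ∷ []) [ t ] [ u ])
  tapeMove l r t u (inj₂ (s , a , right)) = inj₂ (running s , stacks (a ∷ l ∷ []) [] [ t ] [ u ])

  -- From w on the left stack, the machine writes w, then the letter codes of w, then
  -- endCode on the right stack, and runs M on the result.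
  δ′ : State → Vec Symbol 4 → Outcome
  δ′ unload (fzero ∷ r ∷ t ∷ u ∷ []) =
    inj₂ (expand , stacks [ fzero ] (bits endCode ++ [ r ]) [ t ] [ u ])
  δ′ unload (fsuc a ∷ r ∷ t ∷ u ∷ []) =
    inj₂ (unload , stacks [] [ r ] (fsuc a ∷ [ t ]) (fsuc a ∷ [ u ]))
  δ′ expand (l ∷ r ∷ fzero ∷ u ∷ []) =
    inj₂ (reload , stacks [ l ] [ r ] [ fzero ] [ u ])
  δ′ expand (l ∷ r ∷ fsuc a ∷ u ∷ []) =
    inj₂ (expand , stacks [ l ] (bits (letterCode (fsuc a)) ++ [ r ]) [] [ u ])
  δ′ reload (l ∷ r ∷ t ∷ fzero ∷ []) =
    inj₂ (running fzero , stacks [ l ] [ r ] [ t ] [ fzero ])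
  δ′ reload (l ∷ r ∷ t ∷ fsuc a ∷ []) =
    inj₂ (reload , stacks [ l ] (fsuc a ∷ [ r ]) [ t ] [])
  δ′ (running s) (l ∷ r ∷ t ∷ u ∷ []) = tapeMove l r t u (δ s r)

  H : State → List Symbol → List Symbol → List Symbol → List Symbol → Bool → Set
  H s l r t u = Halts δ′ s (stacks l r t u)

  on-stacks : ∀ {P : Fin 4 → Set} → P fzero → P (fsuc fzero) → P (fsuc (fsuc fzero)) →
    P (fsuc (fsuc (fsuc fzero))) → ∀ c → P c
  on-stacks a b c d fzero = a
  on-stacks a b c d (fsuc fzero) = b
  on-stacks a b c d (fsuc (fsuc fzero)) = c
  on-stacks a b c d (fsuc (fsuc (fsuc fzero))) = d

  -- Letters of the word avoid the blank, so a blank on top signals an exhausted stack.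
  marks : List (Fin (2 + g)) → List Symbol
  marks = map fsuc

  -- The word is needed twice, as itself and expanded into letter codes, hence two copies. Both are
  -- reversed because the right stack is built from its far end.
  unloading : ∀ v t u {b} →
    H expand [] (bits endCode) (marks (v ʳ++ t)) (marks (v ʳ++ u)) b →
    H unload (marks v) [] (marks t) (marks u) b
  unloading [] t u {b} h = move refl
    (on-stacks (keep []) (push (bits endCode) []) (keep (marks t)) (keep (marks u)))
    (subst (λ r → H expand [] r (marks t) (marks u) b) (sym (++-identityʳ (bits endCode))) h)
  unloading (a ∷ v) t u h = move refl
    (on-stacks (λ _ → refl) (keep []) (push [ fsuc a ] (marks t)) (push [ fsuc a ] (marks u)))
    (unloading v (a ∷ t) (a ∷ u) h)

  expanded : List (Fin (2 + g)) → List Symbol → List Symbol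
  expanded v r = foldl (λ r a → bits (letterCode (fsuc a)) ++ r) r v

  expanding : ∀ v r u {b} → H reload [] (expanded v r) [] u b → H expand [] r (marks v) u b
  expanding [] r u h = move refl (on-stacks (keep []) (keep r) (keep []) (keep u)) h
  expanding (a ∷ v) r u h = move refl
    (on-stacks (keep []) (push (bits (letterCode (fsuc a))) r) (λ _ → refl) (keep u))
    (expanding v (bits (letterCode (fsuc a)) ++ r) u h)

  run-on : List Symbol → Bool → Set
  run-on w = H (running fzero) [] (top w ∷ drop 1 w) [] []

  reloading : ∀ v r {b} → run-on (marks v ʳ++ r) b → H reload [] r [] (marks v) b
  reloading [] r h = move refl (on-stacks (keep []) (λ _ → refl) (keep []) (keep [])) h
  reloading (a ∷ v) r h = move refl
    (on-stacks (keep []) (push [ fsuc a ] r) (keep []) (λ _ → refl))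
    (reloading v (fsuc a ∷ r) h)

  foldr-expand : ∀ v r →
    foldr (λ a r → bits (letterCode (fsuc a)) ++ r) r v ≡ bits (concatMap letterCode (marks v)) ++ r
  foldr-expand []      r = refl
  foldr-expand (a ∷ v) r = begin
    code ++ foldr _ r v                                       ≡⟨ cong (code ++_) (foldr-expand v r) ⟩
    code ++ bits (concatMap letterCode (marks v)) ++ r        ≡⟨ ++-assoc code _ r ⟨
    (code ++ bits (concatMap letterCode (marks v))) ++ r      ≡⟨ cong (_++ r) (map-++ (bitSym M) (letterCode (fsuc a)) _) ⟨
    bits (concatMap letterCode (marks (a ∷ v))) ++ r          ∎
    where
    open ≡-Reasoning
    code : List Symbol
    code = bits (letterCode (fsuc a))

  marks-reverse : ∀ v r → marks (v ʳ++ []) ʳ++ r ≡ marks v ++ r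
  marks-reverse v r = trans (cong (_ʳ++ r) (map-ʳ++ fsuc v)) (ʳ++-ʳ++ (marks v))

  -- Blanks that `moveHead` adds at the ends of the tape are those that `cell` already finds in an
  -- empty stack, so `≈` absorbs them.
  running-halts : ∀ k s l a r {b} → run M k (cfg s l a r) ≡ inj₁ b → H (running s) l (a ∷ r) [] [] b
  running-halts zero s l a r ()
  running-halts (suc k) s l a r e with δ s a in eq
  running-halts (suc k) s l a r refl | inj₁ b = halt (cong (tapeMove (top l) a fzero fzero) eq)
  running-halts (suc k) s [] a r e | inj₂ (s′ , a′ , left) =
    move (cong (tapeMove fzero a fzero fzero) eq)
      (on-stacks (λ _ → refl) (λ _ → refl) (keep []) (keep []))
      (running-halts k s′ [] fzero (a′ ∷ r) e)
  running-halts (suc k) s (x ∷ l) a r e | inj₂ (s′ , a′ , left) =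
    move (cong (tapeMove x a fzero fzero) eq)
      (on-stacks (λ _ → refl) (λ _ → refl) (keep []) (keep []))
      (running-halts k s′ l x (a′ ∷ r) e)
  running-halts (suc k) s l a [] e | inj₂ (s′ , a′ , right) =
    move (cong (tapeMove (top l) a fzero fzero) eq)
      (on-stacks (push [ a′ ] l) (λ i → sym (keep [] i)) (keep []) (keep []))
      (running-halts k s′ (a′ ∷ l) fzero [] e)
  running-halts (suc k) s l a (x ∷ r) e | inj₂ (s′ , a′ , right) =
    move (cong (tapeMove (top l) a fzero fzero) eq)
      (on-stacks (push [ a′ ] l) (λ _ → refl) (keep []) (keep []))
      (running-halts k s′ (a′ ∷ l) x r e)

  bit : Bool → Fin (2 + g)
  bit false = fzero
  bit true  = fsuc fzero

  marks-bit : ∀ A → marks (map bit A) ≡ bits A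
  marks-bit A = trans (sym (map-∘ A)) (map-cong (λ { false → refl ; true → refl }) A)

  word : List (Fin (2 + g))
  word = map bit (codePrefix δ′)

  self : Instance
  self = problem δ′ (marks word)

  self-code : marks word ++ bits (concatMap letterCode (marks word)) ++ bits endCode ≡ bits (encode self)
  self-code = begin
    marks word ++ bits codes ++ bits endCode          ≡⟨ cong (_++ bits codes ++ bits endCode) (marks-bit (codePrefix δ′)) ⟩
    bits (codePrefix δ′) ++ bits codes ++ bits endCode
      ≡⟨ cong (bits (codePrefix δ′) ++_) (map-++ (bitSym M) codes endCode) ⟨
    bits (codePrefix δ′) ++ bits (codes ++ endCode) ≡⟨ map-++ (bitSym M) (codePrefix δ′) (codes ++ endCode) ⟨
    bits (codePrefix δ′ ++ codes ++ endCode)       ≡⟨ cong bits (problem-code δ′ (marks word)) ⟨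
    bits (encode self)                             ∎
    where
    open ≡-Reasoning
    codes : List Bool
    codes = concatMap letterCode (marks word)

  written : marks (word ʳ++ []) ʳ++ expanded (word ʳ++ []) (bits endCode) ≡ bits (encode self)
  written = begin
    marks (word ʳ++ []) ʳ++ expanded (word ʳ++ []) (bits endCode)
      ≡⟨ marks-reverse word _ ⟩
    marks word ++ expanded (word ʳ++ []) (bits endCode)
      -- A `foldl` over the reversed word is a `foldr` over the word, so the letter codes come out
      -- in order.
      ≡⟨ cong (marks word ++_) (trans (foldl-ʳ++ _ (bits endCode) word) (foldr-expand word (bits endCode))) ⟩
    marks word ++ bits (concatMap letterCode (marks word)) ++ bits endCode
      ≡⟨ self-code ⟩
    bits (encode self) ∎
    where open ≡-Reasoning

  HaltsWith⇒run-on : ∀ w {b} → HaltsWith M w b → run-on (bits w) b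
  HaltsWith⇒run-on []      (k , e) = running-halts k fzero [] fzero [] e
  HaltsWith⇒run-on (c ∷ w) (k , e) = running-halts k fzero [] (bitSym M c) (bits w) e

  self-halts : ∀ {b} → HaltsWith M (encode self) b → Halts δ′ fzero (start δ′ (marks word)) b
  self-halts {b} h = unloading word [] [] (expanding (word ʳ++ []) (bits endCode) (marks (word ʳ++ []))
    (reloading (word ʳ++ []) (expanded (word ʳ++ []) (bits endCode))
      (subst (λ w → run-on w b) (sym written) (HaltsWith⇒run-on (encode self) h))))

-- No case distinction on `P x` is made: if it held, `M` would accept and `accepts` would refute it.
-- So it fails, `M` rejects, and `rejects` yields it after all.
contrary⇒¬Decides : ∀ {M} {P : Instance → Set} x →
  (HaltsWith M (encode x) true → ¬ P x) → (HaltsWith M (encode x) false → P x) → ¬ Decides M P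
contrary⇒¬Decides {P = P} x accepts rejects decides = ¬Px (rejects (proj₂ (decides x) ¬Px))
  where
  ¬Px : ¬ P x
  ¬Px p = accepts (proj₁ (decides x) p) p

mainTheorem8 : ¬ Σ TM (λ M → Decides M RealizableInstance)
mainTheorem8 (M , decides) = contrary⇒¬Decides self
  (λ h → accepting⇒unrealizable δ′ (self-halts h)) (λ h → rejecting⇒realizable δ′ (self-halts h)) decides
  where
  open Diagonal M
  open Machine (3 + TM.q M) 3 (2 + TM.g M)
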